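{- Minimum directed spanning tree enumeration on edge-weighted directed graphs with $m$ edges cannot be solved with both preprocessing and delay in $o(m)$.
   Context: Graphs $G=(V,E)$ have vertex set $V=\{1,\dots,n\}$, $m=|E|$ edges and edge weights $w\colon E\to\mathbb{R}$. An out-branching of a directed graph $G$ is an acyclic subgraph $B=(V,E')$ with $E'\subseteq E$ in which each vertex has in-degree at most $1$. A directed spanning tree (DST) is a weakly connected out-branching; it has $n-1$ edges and exactly one vertex of in-degree $0$, its root. A minimum directed spanning tree (MDST) is a DST minimizing $\sum_{e\in E'}w(e)$. Model: word RAM with word size in $\Omega(\log n)$. The graph is given by (out-)adjacency lists, with edge weights stored alongside the list entries. The algorithm accesses the input by queries, each taking constant time: a degree query for a vertex $v$ returns the out-degree of $v$; a neighbor query for $v$ returns the next, not yet returned out-adjacency of $v$ together with its edge weight. The order of the entries in the lists is arbitrary. Minimum directed spanning tree enumeration: given an edge-weighted directed graph that has a DST, an enumeration algorithm must, for some single MDST $T$ of the graph, emit each edge of $T$ exactly once (irrevocably). Its delay is the worst-case maximum time the algorithm needs to emit the respective next edge; preprocessing time is additional time spent before emitting the first edge (so the first edge is emitted within the sum of the preprocessing and delay bounds). The lower bound is on worst-case complexity over all inputs. -}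

module Defs where

import Algebra.Properties.CommutativeSemigroup as CommutativeSemigroupProperties
open import Algebra.Bundles using (CommutativeMonoid)
open import Data.Bool using (Bool; if_then_else_)
open import Data.Fin using (Fin; toℕ; fromℕ<)
import Data.Fin as Fin
open import Data.List using (List; []; _∷_; _∷ʳ_; length; map; foldr; filter; concatMap; allFin; head; drop)
open import Data.List.Membership.Propositional using (_∈_; _∉_)
open import Data.List.Relation.Binary.Permutation.Propositional using (_↭_)
open import Data.List.Relation.Binary.Sublist.Propositional using (_⊆_)
open import Data.List.Relation.Unary.Unique.Propositional using (Unique)
open import Data.Maybe using (Maybe; just; nothing)
open import Data.Nat using (ℕ; zero; suc; _+_; _*_; _^_; _≤_; _<_; _⊔_; NonZero; _≡ᵇ_; _<?_)
open import Data.Nat.DivMod using (_mod_)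
open import Data.Nat.Properties using (m^n≢0; ≤-trans; m≤m⊔n; m≤n⊔m)
open import Data.Product using (_×_; _,_; ∃; ∃-syntax; proj₁; proj₂)
open import Data.Rational as ℚ using (ℚ; 0ℚ; ½)
import Data.Rational.Properties as ℚ
open import Relation.Binary.Construct.Closure.Equivalence using (EqClosure)
open import Relation.Binary.Construct.Closure.Transitive using (TransClosure)
open import Relation.Binary.PropositionalEquality using (_≡_; refl; sym; trans; cong; subst; subst₂)
open import Relation.Nullary using (¬_; yes; no)

-- Asymptotics.  The positive constant multiplying g is taken to be of the form
-- 1 / c, so that everything stays in ℕ.

infix 4 _∈o_ _∈Ω_

_∈o_ : (ℕ → ℕ) → (ℕ → ℕ) → Set
f ∈o g = ∀ c → ∃[ N ] ∀ k → N ≤ k → c * f k ≤ g k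

_∈Ω_ : (ℕ → ℕ) → (ℕ → ℕ) → Set
f ∈Ω g = ∃[ c ] ∃[ N ] ∀ k → N ≤ k → g k ≤ c * f k

-- Real numbers as Cauchy sequences of rationals.  Different sequences may
-- represent the same real; only the preorder _≤ℝ_ is needed below.

record ℝ : Set where
  constructor mkℝ
  field
    seq    : ℕ → ℚ
    cauchy : ∀ ε → 0ℚ ℚ.< ε → ∃[ N ] ∀ i j → N ≤ i → N ≤ j →
             ℚ.∣ seq i ℚ.- seq j ∣ ℚ.< ε

open ℝ public

fromℚ : ℚ → ℝ
fromℚ q = mkℝ (λ _ → q) λ ε ε>0 →
  0 , λ _ _ _ _ → subst (ℚ._< ε) (sym (cong ℚ.∣_∣ (ℚ.+-inverseʳ q))) ε>0

private
  half>0 : ∀ ε → 0ℚ ℚ.< ε → 0ℚ ℚ.< ½ ℚ.* ε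
  half>0 ε ε>0 = subst (ℚ._< ½ ℚ.* ε) (ℚ.*-zeroʳ ½) (ℚ.*-monoʳ-<-pos ½ ε>0)

  half+half : ∀ ε → ½ ℚ.* ε ℚ.+ ½ ℚ.* ε ≡ ε
  half+half ε = trans (sym (ℚ.*-distribʳ-+ ε ½ ½)) (ℚ.*-identityˡ ε)

  interchange : ∀ a b c d →
    (a ℚ.- c) ℚ.+ (b ℚ.- d) ≡ (a ℚ.+ b) ℚ.- (c ℚ.+ d)
  interchange a b c d =
    trans (+-interchange a (ℚ.- c) b (ℚ.- d))
          (cong ((a ℚ.+ b) ℚ.+_) (sym (ℚ.neg-distrib-+ c d)))
    where
    open CommutativeSemigroupProperties
      (CommutativeMonoid.commutativeSemigroup ℚ.+-0-commutativeMonoid)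
      using () renaming (interchange to +-interchange)

infixl 6 _+ℝ_
infix 4 _≤ℝ_

_+ℝ_ : ℝ → ℝ → ℝ
x +ℝ y = mkℝ (λ i → seq x i ℚ.+ seq y i) λ ε ε>0 →
  let (M , p) = cauchy x (½ ℚ.* ε) (half>0 ε ε>0)
      (N , q) = cauchy y (½ ℚ.* ε) (half>0 ε ε>0)
  in M ⊔ N , λ i j i≥ j≥ →
    subst₂ ℚ._<_
      (cong ℚ.∣_∣ (interchange (seq x i) (seq y i) (seq x j) (seq y j)))
      (half+half ε)
      (ℚ.≤-<-trans
        (ℚ.∣p+q∣≤∣p∣+∣q∣ (seq x i ℚ.- seq x j) (seq y i ℚ.- seq y j))
        (ℚ.+-mono-<
          (p i j (≤-trans (m≤m⊔n M N) i≥) (≤-trans (m≤m⊔n M N) j≥))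
          (q i j (≤-trans (m≤n⊔m M N) i≥) (≤-trans (m≤n⊔m M N) j≥))))

_≤ℝ_ : ℝ → ℝ → Set
x ≤ℝ y = ∀ ε → 0ℚ ℚ.< ε → ∃[ N ] ∀ i → N ≤ i → seq x i ℚ.≤ seq y i ℚ.+ ε

-- A simple edge-weighted directed graph together with the order of the
-- entries in its out-adjacency lists.

record Graph : Set where
  field
    n        : ℕ
    adj      : Fin n → List (Fin n × ℝ)
    simple   : ∀ v → Unique (map proj₁ (adj v))
    loopless : ∀ v → v ∉ map proj₁ (adj v)

open Graph public

record Edge (n : ℕ) : Set where
  constructor edge
  field
    source : Fin n
    target : Fin n
    weight : ℝ

open Edge public

edges : (G : Graph) → List (Edge (n G))
edges G = concatMap (λ u → map (λ (v , w) → edge u v w) (adj G u)) (allFin (n G))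

m : Graph → ℕ
m G = length (edges G)

-- An edge set E′ ⊆ E is a sublist of edges G; since edges G has no repeated
-- entries, this gives each subset exactly once.

EdgeSet : ℕ → Set
EdgeSet n = List (Edge n)

module _ {n : ℕ} (E′ : EdgeSet n) where

  Arc : Fin n → Fin n → Set
  Arc u v = ∃[ w ] edge u v w ∈ E′

  indegree : Fin n → ℕ
  indegree v = length (filter (λ e → target e Fin.≟ v) E′)

  Acyclic : Set
  Acyclic = ∀ v → ¬ TransClosure Arc v v

  -- The null graph does not count as connected.
  WeaklyConnected : Set
  WeaklyConnected = Fin n × (∀ u v → EqClosure Arc u v)

  total : ℝ
  total = foldr (λ e s → weight e +ℝ s) (fromℚ 0ℚ) E′

record IsOutBranching (G : Graph) (B : EdgeSet (n G)) : Set where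
  field
    subgraph   : B ⊆ edges G
    acyclic    : Acyclic B
    indegree≤1 : ∀ v → indegree B v ≤ 1

IsDST : (G : Graph) → EdgeSet (n G) → Set
IsDST G T = IsOutBranching G T × WeaklyConnected T

IsMDST : (G : Graph) → EdgeSet (n G) → Set
IsMDST G T = IsDST G T × (∀ T′ → IsDST G T′ → total T ≤ℝ total T′)

-- The word RAM with word size W.

Word : ℕ → Set
Word W = Fin (2 ^ W)

toWord : (W : ℕ) → ℕ → Word W
toWord W k = _mod_ k (2 ^ W) {{m^n≢0 2 W}}

Address Label : Set
Address = ℕ
Label   = ℕ

-- There are two memories, one for words and one for weights.  No particular
-- repertoire of arithmetic is fixed: any operation on words (uniform in the
-- word size) and any operation or test on weights may serve as a unit-time
-- instruction.  Operands are direct addresses; load and store are indirect.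
-- Vertex i of a graph is represented by the word of value toℕ i.

data Instruction : Set where
  word-op      : (∀ W → Word W → Word W → Word W) → (dst a b : Address) → Instruction
  load store   : (a ptr : Address) → Instruction
  jump-if      : (∀ W → Word W → Word W → Bool) → (a b : Address) → Label → Instruction
  weight-op    : (ℝ → ℝ → ℝ) → (dst a b : Address) → Instruction
  load-weight store-weight : (a ptr : Address) → Instruction
  jump-if-weight : (ℝ → ℝ → Bool) → (a b : Address) → Label → Instruction
  degree       : (v dst : Address) → Instruction
  neighbor     : (v dst wdst : Address) → Instruction
  emit         : (u v : Address) → Instruction
  halt         : Instruction

Program : Set
Program = List Instruction

-- returned v is the number of neighbors of v returned so far; output lists
-- the emitted vertex pairs, in order of emission.

record Config (W n : ℕ) : Set where
  constructor config
  field
    pc       : Label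
    words    : Address → Word W
    weights  : Address → ℝ
    returned : Fin n → ℕ
    output   : List (ℕ × ℕ)

open Config public

_[_≔_] : {A : Set} → (ℕ → A) → ℕ → A → ℕ → A
(f [ i ≔ x ]) j = if j ≡ᵇ i then x else f j

increment : ∀ {n} → Fin n → (Fin n → ℕ) → Fin n → ℕ
increment v f u with u Fin.≟ v
... | yes _ = suc (f u)
... | no  _ = f u

toVertex : ∀ W n → Word W → Maybe (Fin n)
toVertex W n x with toℕ x <? n
... | yes x<n = just (fromℕ< x<n)
... | no  _   = nothing

module _ {W : ℕ} (G : Graph) where

  -- Queries for words that denote no vertex, and neighbor queries for an
  -- exhausted list, only advance the program counter.

  degreeQuery : Maybe (Fin (n G)) → Address → Config W (n G) → Config W (n G)
  degreeQuery nothing  dst c = c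
  degreeQuery (just v) dst c =
    record c { words = words c [ dst ≔ toWord W (length (adj G v)) ] }

  neighborQuery : Maybe (Fin (n G)) → (dst wdst : Address) →
                  Config W (n G) → Config W (n G)
  neighborQuery nothing  dst wdst c = c
  neighborQuery (just v) dst wdst c with head (drop (returned c v) (adj G v))
  ... | nothing      = c
  ... | just (u , w) = record c
    { words    = words c [ dst ≔ toWord W (toℕ u) ]
    ; weights  = weights c [ wdst ≔ w ]
    ; returned = increment v (returned c)
    }

  next : Config W (n G) → Config W (n G)
  next c = record c { pc = suc (pc c) }

  execute : Instruction → Config W (n G) → Config W (n G)
  execute (word-op f dst a b) c =
    next (record c { words = words c [ dst ≔ f W (words c a) (words c b) ] })
  execute (load a ptr) c =
    next (record c { words = words c [ a ≔ words c (toℕ (words c ptr)) ] })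
  execute (store a ptr) c =
    next (record c { words = words c [ toℕ (words c ptr) ≔ words c a ] })
  execute (jump-if f a b l) c =
    if f W (words c a) (words c b) then record c { pc = l } else next c
  execute (weight-op f dst a b) c =
    next (record c { weights = weights c [ dst ≔ f (weights c a) (weights c b) ] })
  execute (load-weight a ptr) c =
    next (record c { weights = weights c [ a ≔ weights c (toℕ (words c ptr)) ] })
  execute (store-weight a ptr) c =
    next (record c { weights = weights c [ toℕ (words c ptr) ≔ weights c a ] })
  execute (jump-if-weight f a b l) c =
    if f (weights c a) (weights c b) then record c { pc = l } else next c
  execute (degree v dst) c =
    next (degreeQuery (toVertex W (n G) (words c v)) dst c)
  execute (neighbor v dst wdst) c =
    next (neighborQuery (toVertex W (n G) (words c v)) dst wdst c)
  execute (emit u v) c =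
    next (record c { output = output c ∷ʳ (toℕ (words c u) , toℕ (words c v)) })
  execute halt c = c

  step : Program → Config W (n G) → Config W (n G)
  step P c with head (drop (pc c) P)
  ... | nothing = c
  ... | just i  = execute i c

  -- The numbers of vertices and edges are available from the start, in the
  -- cells 0 and 1.
  initial : Config W (n G)
  initial = config 0
    (((λ _ → toWord W 0) [ 1 ≔ toWord W (m G) ]) [ 0 ≔ toWord W (n G) ])
    (λ _ → fromℚ 0ℚ) (λ _ → 0) []

  run : Program → ℕ → Config W (n G)
  run P zero    = initial
  run P (suc t) = step P (run P t)

-- The program P with word size W, run on G, enumerates some MDST of G with
-- the given bounds on preprocessing time and delay.

record EnumeratesMDST (W : ℕ) (P : Program) (G : Graph)
                      (preprocessing delay : ℕ) : Set where
  emitted : ℕ → List (ℕ × ℕ)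
  emitted t = output (run {W} G P t)

  count : ℕ → ℕ
  count t = length (emitted t)

  field
    tree     : EdgeSet (n G)
    isMDST   : IsMDST G tree
    -- Eventually every edge of the tree, and nothing else, has been emitted
    -- exactly once.
    complete : ∃[ t₀ ] ∀ t → t₀ ≤ t →
               emitted t ↭ map (λ e → toℕ (source e) , toℕ (target e)) tree
    first    : 0 < length tree → 0 < count (preprocessing + delay)
    -- If an edge that is not the last one is emitted in step t + 1, then the
    -- next one follows within delay many steps.
    further  : ∀ t → count t < count (suc t) → count (suc t) < length tree →
               count (suc t) < count (suc t + delay)

-- The program P solves MDST enumeration on all graphs that have a DST, where
-- the word size may depend on the number of vertices, and the preprocessing
-- time and delay are bounded in terms of the number of edges.

SolvesMDSTEnumeration : (wordSize : ℕ → ℕ) → Program →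
                        (preprocessing delay : ℕ → ℕ) → Set
SolvesMDSTEnumeration wordSize P preprocessing delay =
  ∀ (G : Graph) → ∃ (IsDST G) →
  EnumeratesMDST (wordSize (n G)) P G (preprocessing (m G)) (delay (m G))

{-# OPTIONS --safe #-}
-- On a complete digraph with all weights 0, let (u , v) be the first emitted
-- edge.  If it is emitted after o(m) steps, then some list entry x → v with
-- x ≠ u has not been returned by then, because the adjacency lists are arranged
-- such that the entries for v come late in the lists of half of the vertices.
-- Lowering the weight of x → v to −1 does not change the run up to this point.
-- The star rooted at x now has weight −1, so every MDST contains x → v and,
-- having indegree at most 1 at v, cannot contain (u , v).
module Submission where

open import Defs
open import Data.Bool using (true; false; if_then_else_; _∧_)
open import Data.Fin using (Fin; toℕ; combine; quotient; opposite; zero; suc)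
import Data.Fin as Fin
open import Data.Fin.Properties using (toℕ-injective; remQuot-combine; combine-remQuot; combine-injectiveʳ)
open import Data.List using (List; []; _∷_; _++_; map; filter; concatMap; allFin; head; drop; length)
open import Data.List.Properties using (length-map; length-filter; length-++; length-tabulate; map-++; map-∘; map-id; map-cong-local; ++-identityʳ)
open import Data.List.Membership.Propositional using (_∈_; _∉_; find)
open import Data.List.Membership.Propositional.Properties using (∈-map⁺; ∈-map⁻; ∈-filter⁺; ∈-filter⁻; ∈-allFin; ∈-++⁺ˡ; ∈-++⁺ʳ; ∈-++⁻; ∈-concatMap⁻)
open import Data.List.Relation.Binary.Pointwise using (≡⇒Pointwise-≡)
open import Data.List.Relation.Binary.Permutation.Propositional.Properties using (∈-resp-↭)
open import Data.List.Relation.Binary.Sublist.Propositional using (_⊆_; lookup)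
open import Data.List.Relation.Binary.Sublist.Propositional.Properties using (length-mono-≤)
open import Data.List.Relation.Binary.Sublist.Setoid.Properties using (xs∈xss⇒xs⊆concat[xss])
open import Data.List.Relation.Unary.All as All using (All; []; _∷_)
open import Data.List.Relation.Unary.All.Properties using (¬Any⇒All¬)
open import Data.List.Relation.Unary.Any as Any using (Any; here; there; any?)
open import Data.List.Relation.Unary.AllPairs using ([]; _∷_)
open import Data.List.Relation.Unary.Unique.Propositional using (Unique)
import Data.List.Relation.Unary.Unique.Propositional.Properties as Unique
open import Data.Maybe using (just; nothing)
open import Data.Nat using (ℕ; zero; suc; _+_; _*_; _≤_; _<_; z≤n; s≤s; z<s; s<s; _<?_)
open import Data.Nat.ListAction using (sum)
open import Data.Nat.Logarithm using (⌊log₂_⌋)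
open import Data.Nat.Properties
open import Data.Nat.Tactic.RingSolver using (solve-∀)
open import Data.Product using (_×_; _,_; ∃-syntax; proj₁; proj₂)
import Data.Rational as ℚ
open import Data.Rational using (ℚ; 0ℚ; 1ℚ; ½)
import Data.Rational.Properties as ℚ
open import Data.Sum using (_⊎_; inj₁; inj₂)
open import Function using (_∘_)
open import Relation.Binary.Construct.Closure.ReflexiveTransitive using (ε; _◅_; _◅◅_)
open import Relation.Binary.Construct.Closure.Symmetric using (fwd; bwd)
open import Relation.Binary.Construct.Closure.Transitive using (TransClosure; [_]; _∷_)
open import Relation.Binary.PropositionalEquality
open import Relation.Nullary using (¬_; yes; no; ¬?; does; contradiction; _×-dec_)
open import Relation.Nullary.Decidable using (decidable-stable; dec-true)

-- Lists and counting.

private variable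
  A B : Set

length-concatMap-cong : {f g : A → List B} → (∀ x → length (f x) ≡ length (g x)) →
                        ∀ xs → length (concatMap f xs) ≡ length (concatMap g xs)
length-concatMap-cong eq [] = refl
length-concatMap-cong {f = f} {g} eq (x ∷ xs) = begin
  length (f x ++ concatMap f xs)         ≡⟨ length-++ (f x) ⟩
  length (f x) + length (concatMap f xs) ≡⟨ cong₂ _+_ (eq x) (length-concatMap-cong eq xs) ⟩
  length (g x) + length (concatMap g xs) ≡⟨ length-++ (g x) ⟨
  length (g x ++ concatMap g xs)         ∎
  where open ≡-Reasoning

length-concatMap-≤ : {f : A → List B} {b : ℕ} → (∀ x → length (f x) ≤ b) →
                     ∀ xs → length (concatMap f xs) ≤ length xs * b
length-concatMap-≤ le [] = z≤n
length-concatMap-≤ {f = f} le (x ∷ xs) rewrite length-++ (f x) {concatMap f xs} =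
  +-mono-≤ (le x) (length-concatMap-≤ le xs)

head-drop-++ : ∀ (xs ys : List A) {r} → r < length xs →
               head (drop r (xs ++ ys)) ≡ head (drop r xs)
head-drop-++ (x ∷ xs) ys {zero}  _         = refl
head-drop-++ (x ∷ xs) ys {suc r} (s<s r<l) = head-drop-++ xs ys r<l

sum-map-≥ : ∀ (f : A → ℕ) {b} {xs} → All (λ x → b ≤ f x) xs → length xs * b ≤ sum (map f xs)
sum-map-≥ f []         = z≤n
sum-map-≥ f (px ∷ pxs) = +-mono-≤ px (sum-map-≥ f pxs)

module _ {n : ℕ} where

  -- Distinctness of the entries means that filtering out `v` removes at most one of them.
  length-≤-filter-≢ : ∀ (v : Fin n) {xs} → Unique xs →
                      length xs ≤ suc (length (filter (λ x → ¬? (x Fin.≟ v)) xs))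
  length-≤-filter-≢ v []                  = z≤n
  length-≤-filter-≢ v {x ∷ xs} (x∉ ∷ uxs) with x Fin.≟ v
  ... | no  _    = s≤s (length-≤-filter-≢ v uxs)
  ... | yes refl = s≤s (≤-reflexive (cong length (sym (filter-≢-∉ x∉))))
    where
    filter-≢-∉ : ∀ {ys} → All (x ≢_) ys → filter (λ y → ¬? (y Fin.≟ x)) ys ≡ ys
    filter-≢-∉ [] = refl
    filter-≢-∉ {y ∷ _} (x≢y ∷ ps) with y Fin.≟ x
    ... | yes y≡x = contradiction (sym y≡x) x≢y
    ... | no  _   = cong (y ∷_) (filter-≢-∉ ps)

  increment-≥ : ∀ (v : Fin n) f u → f u ≤ increment v f u
  increment-≥ v f u with u Fin.≟ v
  ... | yes _ = n≤1+n _
  ... | no  _ = ≤-refl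

  -- Only the summand at `v` changes, and it occurs at most once among distinct entries.
  sum-increment-≤ : ∀ (v : Fin n) f {xs} → Unique xs →
                    sum (map (increment v f) xs) ≤ suc (sum (map f xs))
  sum-increment-≤ v f []                  = z≤n
  sum-increment-≤ v f {x ∷ xs} (x∉ ∷ uxs) with x Fin.≟ v
  ... | no  _    = ≤-trans (+-monoʳ-≤ (f x) (sum-increment-≤ v f uxs))
                           (≤-reflexive (+-suc (f x) _))
  ... | yes refl = s≤s (+-monoʳ-≤ (f x) (≤-reflexive (cong sum (map-cong-local (All.map unchanged x∉)))))
    where
    unchanged : ∀ {y} → x ≢ y → increment x f y ≡ f y
    unchanged {y} x≢y with y Fin.≟ x
    ... | yes y≡x = contradiction (sym y≡x) x≢y
    ... | no  _   = refl

-- Effect of machine steps on the query counters and the output.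

module _ {W : ℕ} (G : Graph) where

  private
    -- At most one list entry is returned per step, which ties the explored part of the input to the
    -- running time.
    _returns_ : Config W (n G) → Config W (n G) → Set
    c returns d = returned d ≡ returned c ⊎ ∃[ v ] returned d ≡ increment v (returned c)

    -- Stated as an extension of the old output, because emissions are irrevocable.
    _emits_ : Config W (n G) → Config W (n G) → Set
    c emits d = ∃[ ps ] output d ≡ output c ++ ps

    nothing-emitted : ∀ {xs ys : List (ℕ × ℕ)} → ys ≡ xs → ∃[ ps ] ys ≡ xs ++ ps
    nothing-emitted eq = [] , trans eq (sym (++-identityʳ _))

    neighborQuery-effect : ∀ mv dst wdst c → let d = neighborQuery G mv dst wdst c in
                           c returns d × output d ≡ output c
    neighborQuery-effect nothing  dst wdst c = inj₁ refl , refl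
    neighborQuery-effect (just v) dst wdst c with head (drop (returned c v) (adj G v))
    ... | nothing = inj₁ refl , refl
    ... | just _  = inj₂ (v , refl) , refl

    degreeQuery-effect : ∀ mv dst c → let d = degreeQuery G mv dst c in
                         c returns d × output d ≡ output c
    degreeQuery-effect nothing  dst c = inj₁ refl , refl
    degreeQuery-effect (just v) dst c = inj₁ refl , refl

    execute-effect : ∀ i c → let d = execute G i c in c returns d × c emits d
    execute-effect (word-op f dst a b) c = inj₁ refl , nothing-emitted refl
    execute-effect (load a ptr) c = inj₁ refl , nothing-emitted refl
    execute-effect (store a ptr) c = inj₁ refl , nothing-emitted refl
    execute-effect (jump-if f a b l) c with f W (words c a) (words c b)
    ... | true  = inj₁ refl , nothing-emitted refl
    ... | false = inj₁ refl , nothing-emitted refl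
    execute-effect (weight-op f dst a b) c = inj₁ refl , nothing-emitted refl
    execute-effect (load-weight a ptr) c = inj₁ refl , nothing-emitted refl
    execute-effect (store-weight a ptr) c = inj₁ refl , nothing-emitted refl
    execute-effect (jump-if-weight f a b l) c with f (weights c a) (weights c b)
    ... | true  = inj₁ refl , nothing-emitted refl
    ... | false = inj₁ refl , nothing-emitted refl
    execute-effect (degree v dst) c
      with r , o ← degreeQuery-effect (toVertex W (n G) (words c v)) dst c =
      r , nothing-emitted o
    execute-effect (neighbor v dst wdst) c
      with r , o ← neighborQuery-effect (toVertex W (n G) (words c v)) dst wdst c =
      r , nothing-emitted o
    execute-effect (emit u v) c = inj₁ refl , _ , refl
    execute-effect halt c = inj₁ refl , nothing-emitted refl

    step-effect : ∀ P c → let d = step G P c in c returns d × c emits d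
    step-effect P c with head (drop (pc c) P)
    ... | nothing = inj₁ refl , nothing-emitted refl
    ... | just i  = execute-effect i c

  returned-step-≥ : ∀ P c v → returned c v ≤ returned (step G P c) v
  returned-step-≥ P c v with proj₁ (step-effect P c)
  ... | inj₁ eq       = ≤-reflexive (sym (cong-app eq v))
  ... | inj₂ (u , eq) = ≤-trans (increment-≥ u (returned c) v) (≤-reflexive (sym (cong-app eq v)))

  -- All counters start at 0, and each step increments at most one of them by one.
  sum-returned-≤ : ∀ P t {xs} → Unique xs → sum (map (returned (run {W} G P t)) xs) ≤ t
  sum-returned-≤ P zero {xs} _ = ≤-reflexive (sum-zeros xs)
    where
    sum-zeros : ∀ (xs : List (Fin (n G))) → sum (map (λ _ → 0) xs) ≡ 0
    sum-zeros []       = refl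
    sum-zeros (_ ∷ xs) = sum-zeros xs
  sum-returned-≤ P (suc t) uxs with proj₁ (step-effect P (run G P t))
  ... | inj₁ eq       rewrite eq = m≤n⇒m≤1+n (sum-returned-≤ P t uxs)
  ... | inj₂ (u , eq) rewrite eq =
    ≤-trans (sum-increment-≤ u _ uxs) (s≤s (sum-returned-≤ P t uxs))

  ∈-output-+ : ∀ P t s {p} → p ∈ output (run {W} G P t) → p ∈ output (run {W} G P (s + t))
  ∈-output-+ P t zero    p∈ = p∈
  ∈-output-+ P t (suc s) p∈ with ps , eq ← proj₂ (step-effect P (run G P (s + t))) =
    subst (_ ∈_) (sym eq) (∈-++⁺ˡ (∈-output-+ P t s p∈))

  -- A pair emitted at time `t` is still in the output at time `t₀ + t`, when the output is a
  -- permutation of the tree edges. So even an early emission commits to an edge of the final tree.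
  emitted⇒∈tree : ∀ {P pre del} (E : EnumeratesMDST W P G pre del) t {p} → p ∈ output (run {W} G P t) →
                  ∃[ e ] e ∈ EnumeratesMDST.tree E × p ≡ (toℕ (source e) , toℕ (target e))
  emitted⇒∈tree {P} E t p∈
    with t₀ , all-emitted ← EnumeratesMDST.complete E =
    ∈-map⁻ _ (∈-resp-↭ (all-emitted (t₀ + t) (m≤m+n t₀ t)) (∈-output-+ P t t₀ p∈))

-- In-degrees, connectivity and spanning stars.

filter-target-≡∅ : ∀ {n} {v : Fin n} (es : EdgeSet n) → All (v ≢_) (map target es) →
                   filter (λ e → target e Fin.≟ v) es ≡ []
filter-target-≡∅ [] [] = refl
filter-target-≡∅ {v = v} (e ∷ es) (v≢ ∷ ps) with target e Fin.≟ v
... | yes eq = contradiction (sym eq) v≢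
... | no  _  = filter-target-≡∅ es ps

Unique-targets⇒indegree≤1 : ∀ {n} (es : EdgeSet n) → Unique (map target es) → ∀ v → indegree es v ≤ 1
Unique-targets⇒indegree≤1 [] _ v = z≤n
Unique-targets⇒indegree≤1 (e ∷ es) (e∉ ∷ u) v with target e Fin.≟ v
... | yes refl rewrite filter-target-≡∅ es e∉ = ≤-refl
... | no  _    = Unique-targets⇒indegree≤1 es u v

0<length⇒∈ : ∀ {xs : List A} → 0 < length xs → ∃[ x ] x ∈ xs
0<length⇒∈ {xs = x ∷ _} _ = x , here refl

length≤1⇒≡ : ∀ {x y : A} {xs} → length xs ≤ 1 → x ∈ xs → y ∈ xs → x ≡ y
length≤1⇒≡ {xs = _ ∷ []} _ (here refl) (here refl) = refl
length≤1⇒≡ {xs = _ ∷ _ ∷ _} (s≤s ())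

indegree≤1⇒≡ : ∀ {n} {es : EdgeSet n} {v e e′} → indegree es v ≤ 1 →
               e ∈ es → target e ≡ v → e′ ∈ es → target e′ ≡ v → e ≡ e′
indegree≤1⇒≡ le e∈ et e′∈ e′t =
  length≤1⇒≡ le (∈-filter⁺ _ e∈ et) (∈-filter⁺ _ e′∈ e′t)

-- Without edges only the trivial path remains, and it cannot join two distinct vertices. This
-- supplies the premise of `first`.
WeaklyConnected⇒nonempty : ∀ {n} {es : EdgeSet n} {u v : Fin n} → u ≢ v → WeaklyConnected es → 0 < length es
WeaklyConnected⇒nonempty {es = _ ∷ _} _ _ = z<s
WeaklyConnected⇒nonempty {es = []} {u} {v} u≢v (_ , connected) with connected u v
... | ε                = contradiction refl u≢v
... | fwd (_ , ()) ◅ _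
... | bwd (_ , ()) ◅ _

∈-edges⁻ : ∀ (G : Graph) {e} → e ∈ edges G → (target e , weight e) ∈ adj G (source e)
∈-edges⁻ G e∈ with u , _ , e∈u ← find (∈-concatMap⁻ _ {xs = allFin (n G)} e∈)
              with _ , vw∈ , refl ← ∈-map⁻ _ e∈u = vw∈

module _ (G : Graph) (x : Fin (n G)) where

  star : EdgeSet (n G)
  star = map (λ (v , w) → edge x v w) (adj G x)

  star⊆edges : star ⊆ edges G
  star⊆edges = xs∈xss⇒xs⊆concat[xss] (setoid _) (Any.map ≡⇒Pointwise-≡ (∈-map⁺ _ (∈-allFin x)))

  -- Every arc leaves `x` and, without loops, none enters it, so there is no closed walk. Any two
  -- vertices are joined through `x`.
  star-isDST : (∀ v → v ≢ x → v ∈ map proj₁ (adj G x)) → IsDST G star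
  star-isDST full = record
    { subgraph   = star⊆edges
    -- A closed walk at `v` forces `v ≡ x` by its first arc and `v ≢ x` by its last.
    ; acyclic    = λ v p → last-≢x p (first-≡x p)
    ; indegree≤1 = Unique-targets⇒indegree≤1 star
        (subst Unique (map-∘ (adj G x)) (simple G x))
    } , x , λ u v → from-x u ◅◅ to-x v
    where
    first-≡x : ∀ {u v} → TransClosure (Arc star) u v → u ≡ x
    arc-source : ∀ {u v} → Arc star u v → u ≡ x
    arc-source (_ , e∈) with _ , _ , refl ← ∈-map⁻ _ e∈ = refl
    first-≡x [ a ]   = arc-source a
    first-≡x (a ∷ _) = arc-source a
    last-≢x : ∀ {u v} → TransClosure (Arc star) u v → v ≢ x
    last-≢x [ _ , e∈ ] refl with _ , p∈ , refl ← ∈-map⁻ _ e∈ = loopless G x (∈-map⁺ proj₁ p∈)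
    last-≢x (_ ∷ p) = last-≢x p
    arc : ∀ v → v ≢ x → Arc star x v
    arc v v≢x with (_ , w) , p∈ , refl ← ∈-map⁻ _ (full v v≢x) = w , ∈-map⁺ _ p∈
    from-x : ∀ v → _
    from-x v with v Fin.≟ x
    ... | yes refl = ε
    ... | no  v≢x  = bwd (arc v v≢x) ◅ ε
    to-x : ∀ v → _
    to-x v with v Fin.≟ x
    ... | yes refl = ε
    ... | no  v≢x  = fwd (arc v v≢x) ◅ ε

-- Total weights, computed with rationals at a fixed index of the Cauchy sequences.

seq-total-zero : ∀ {n} (es : EdgeSet n) i → All (λ e → seq (weight e) i ≡ 0ℚ) es → seq (total es) i ≡ 0ℚ
seq-total-zero []       i []       = refl
seq-total-zero (e ∷ es) i (p ∷ ps) = cong₂ ℚ._+_ p (seq-total-zero es i ps)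

seq-total-≤0 : ∀ {n} (es : EdgeSet n) i → All (λ e → seq (weight e) i ℚ.≤ 0ℚ) es → seq (total es) i ℚ.≤ 0ℚ
seq-total-≤0 []       i []       = ℚ.≤-refl
seq-total-≤0 (e ∷ es) i (p ∷ ps) = ℚ.+-mono-≤ p (seq-total-≤0 es i ps)

-- The other summands are nonpositive and can only lower the sum.
seq-total-≤ : ∀ {n} {es : EdgeSet n} {e} i → All (λ e → seq (weight e) i ℚ.≤ 0ℚ) es → e ∈ es →
              seq (total es) i ℚ.≤ seq (weight e) i
seq-total-≤ {es = e ∷ es} i (_ ∷ ps) (here refl) =
  subst (seq (total (e ∷ es)) i ℚ.≤_) (ℚ.+-identityʳ _) (ℚ.+-monoʳ-≤ (seq (weight e) i) (seq-total-≤0 es i ps))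
seq-total-≤ {es = e′ ∷ es} {e} i (p ∷ ps) (there e∈) =
  subst (seq (total (e′ ∷ es)) i ℚ.≤_) (ℚ.+-identityˡ _) (ℚ.+-mono-≤ p (seq-total-≤ i ps e∈))

-- Complete digraphs on two blocks of `k` vertices, with adversarially ordered lists.

module CompleteDigraph (k : ℕ) where

  Vertex : Set
  Vertex = Fin (2 * k)

  block : Fin 2 → List Vertex
  block b = map (combine b) (allFin k)

  -- `near x` is the block containing `x`, `far x` the other one. Listing the far block first puts
  -- `v` behind `k` other entries in the list of each vertex of its own block except `v` itself.
  near far order : Vertex → List Vertex
  near x  = block (quotient k x)
  far x   = block (opposite (quotient k x))
  order x = far x ++ filter (λ y → ¬? (y Fin.≟ x)) (near x)

  length-block : ∀ b → length (block b) ≡ k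
  length-block b = trans (length-map (combine b) (allFin k)) (length-tabulate _)

  block-unique : ∀ b → Unique (block b)
  block-unique b = Unique.map⁺ (λ {i} {j} → combine-injectiveʳ b i b j) (Unique.allFin⁺ k)

  ∈-near : ∀ x → x ∈ near x
  ∈-near x = subst (_∈ near x) (combine-remQuot {2} k x) (∈-map⁺ _ (∈-allFin _))

  ∈-block⇒quotient≡ : ∀ {b x} → x ∈ block b → quotient k x ≡ b
  ∈-block⇒quotient≡ {b} x∈ with i , _ , refl ← ∈-map⁻ _ x∈ = cong proj₁ (remQuot-combine b i)

  opposite-≢ : ∀ (b : Fin 2) → opposite b ≢ b
  opposite-≢ zero       ()
  opposite-≢ (suc zero) ()

  ≡-or-opposite : ∀ (a b : Fin 2) → a ≡ b ⊎ a ≡ opposite b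
  ≡-or-opposite zero       zero       = inj₁ refl
  ≡-or-opposite zero       (suc zero) = inj₂ refl
  ≡-or-opposite (suc zero) zero       = inj₂ refl
  ≡-or-opposite (suc zero) (suc zero) = inj₁ refl

  near⇒∉far : ∀ {x v} → x ∈ near v → v ∉ far x
  near⇒∉far {x} {v} x∈ v∈ =
    opposite-≢ (quotient k x) (trans (sym (∈-block⇒quotient≡ v∈)) (sym (∈-block⇒quotient≡ {quotient k v} x∈)))

  order-unique : ∀ x → Unique (order x)
  order-unique x = Unique.++⁺ (block-unique (opposite (quotient k x))) (Unique.filter⁺ _ (block-unique (quotient k x)))
    λ (y∈far , y∈near) → opposite-≢ (quotient k x)
      (trans (sym (∈-block⇒quotient≡ y∈far)) (∈-block⇒quotient≡ (proj₁ (∈-filter⁻ _ {xs = near x} y∈near))))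

  order-loopless : ∀ x → x ∉ order x
  order-loopless x x∈ with ∈-++⁻ (far x) x∈
  ... | inj₁ x∈far  = near⇒∉far (∈-near x) x∈far
  ... | inj₂ x∈near = proj₂ (∈-filter⁻ _ {xs = near x} x∈near) refl

  ∈-order : ∀ x y → y ≢ x → y ∈ order x
  ∈-order x y y≢x with ≡-or-opposite (quotient k y) (quotient k x)
  ... | inj₁ eq = ∈-++⁺ʳ (far x) (∈-filter⁺ _ (subst (λ b → y ∈ block b) eq (∈-near y)) y≢x)
  ... | inj₂ eq = ∈-++⁺ˡ (subst (λ b → y ∈ block b) eq (∈-near y))

  length-order-≥ : ∀ x → k ≤ length (order x)
  length-order-≥ x rewrite length-++ (far x) {filter (λ y → ¬? (y Fin.≟ x)) (near x)}
                         | length-block (opposite (quotient k x)) = m≤m+n k _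

  length-order-≤ : ∀ x → length (order x) ≤ 2 * k
  length-order-≤ x rewrite length-++ (far x) {filter (λ y → ¬? (y Fin.≟ x)) (near x)}
                         | length-block (opposite (quotient k x)) =
    +-monoʳ-≤ k (≤-trans (length-filter _ (near x))
                         (≤-reflexive (trans (length-block (quotient k x)) (sym (+-identityʳ k)))))

  -- The order of the lists is independent of `cost`, so two networks differ in nothing but their
  -- weights.
  network : (Vertex → Vertex → ℚ) → Graph
  network cost = record
    { n        = 2 * k
    ; adj      = λ x → map (λ y → y , fromℚ (cost x y)) (order x)
    ; simple   = λ x → subst Unique (sym (targets x)) (order-unique x)
    ; loopless = λ x x∈ → order-loopless x (subst (x ∈_) (targets x) x∈)
    }
    where
    targets : ∀ x → map proj₁ (map (λ y → y , fromℚ (cost x y)) (order x)) ≡ order x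
    targets x = trans (sym (map-∘ (order x))) (map-id (order x))

  module _ (cost : Vertex → Vertex → ℚ) where

    private G = network cost

    length-adj : ∀ x → length (adj G x) ≡ length (order x)
    length-adj x = length-map _ (order x)

    ∈-edges-weight : ∀ {e} → e ∈ edges G → weight e ≡ fromℚ (cost (source e) (target e))
    ∈-edges-weight e∈ with _ , _ , refl ← ∈-map⁻ _ (∈-edges⁻ G e∈) = refl

    ∈-star : ∀ x y → y ≢ x → edge x y (fromℚ (cost x y)) ∈ star G x
    ∈-star x y y≢x = ∈-map⁺ _ (∈-map⁺ _ (∈-order x y y≢x))

    network-star-isDST : ∀ x → IsDST G (star G x)
    network-star-isDST x = star-isDST G x λ y y≢x → ∈-map⁺ proj₁ (∈-map⁺ _ (∈-order x y y≢x))

    m-≤ : m G ≤ (2 * k) * (2 * k)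
    m-≤ = subst (λ l → m G ≤ l * (2 * k)) (length-tabulate {n = 2 * k} (λ i → i))
      (length-concatMap-≤ (λ x → ≤-trans (≤-reflexive (trans (length-map _ (adj G x)) (length-adj x)))
                                         (length-order-≤ x))
                          (allFin (2 * k)))

    -- Large `k` thus forces large `m`, beyond the thresholds hidden in the `o(m)` bounds. Counting
    -- the edges of one star suffices.
    m-≥ : Vertex → k ≤ m G
    m-≥ x = begin
      k                 ≤⟨ length-order-≥ x ⟩
      length (order x)  ≡⟨ length-adj x ⟨
      length (adj G x)  ≡⟨ length-map _ (adj G x) ⟨
      length (star G x) ≤⟨ length-mono-≤ (star⊆edges G x) ⟩
      m G               ∎
      where open ≤-Reasoning

  -- Networks that differ only in the weight of an unseen arc are indistinguishable.

  m-network : ∀ c c′ → m (network c) ≡ m (network c′)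
  m-network c c′ = length-concatMap-cong
    (λ x → trans (trans (length-map _ (adj (network c) x)) (trans (length-adj c x) (sym (length-adj c′ x))))
                 (sym (length-map _ (adj (network c′) x))))
    (allFin (2 * k))

  module Indistinguishable {W : ℕ} (c c′ : Vertex → Vertex → ℚ) {x v : Vertex}
    (agree : ∀ a b → a ≢ x ⊎ b ≢ v → c a b ≡ c′ a b) (v∉far : v ∉ far x) where

    private
      G = network c
      H = network c′

    -- Only the list of `x` can differ, and only at its entry for `v`. The first `k` entries of that
    -- list form `far x`, which does not contain `v`.
    entry-agree : ∀ a r → (a ≡ x → r < k) → head (drop r (adj G a)) ≡ head (drop r (adj H a))
    entry-agree a r r<k with a Fin.≟ x
    ... | no a≢x = cong (head ∘ drop r)
      (map-cong-local (All.universal (λ b → cong (λ q → b , fromℚ q) (agree a b (inj₁ a≢x))) (order a)))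
    ... | yes refl = begin
      head (drop r (map (entry c) (order x))) ≡⟨ in-far c ⟩
      head (drop r (map (entry c) (far x)))   ≡⟨ cong (head ∘ drop r) (map-cong-local (All.tabulate same)) ⟩
      head (drop r (map (entry c′) (far x)))  ≡⟨ in-far c′ ⟨
      head (drop r (map (entry c′) (order x))) ∎
      where
      open ≡-Reasoning
      entry : (Vertex → Vertex → ℚ) → Vertex → Vertex × ℝ
      entry d y = y , fromℚ (d x y)
      same : ∀ {y} → y ∈ far x → entry c y ≡ entry c′ y
      same y∈ = cong (λ q → _ , fromℚ q) (agree x _ (inj₂ λ { refl → v∉far y∈ }))
      in-far : ∀ d → head (drop r (map (entry d) (order x))) ≡ head (drop r (map (entry d) (far x)))
      in-far d = trans (cong (head ∘ drop r) (map-++ (entry d) (far x) _))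
        (head-drop-++ (map (entry d) (far x)) _
          (subst (r <_) (sym (trans (length-map (entry d) (far x)) (length-block (opposite (quotient k x))))) (r<k refl)))

    degreeQuery-agree : ∀ ma dst (s : Config W (2 * k)) → degreeQuery G ma dst s ≡ degreeQuery H ma dst s
    degreeQuery-agree nothing  dst s = refl
    degreeQuery-agree (just a) dst s =
      cong (λ l → record s { words = words s [ dst ≔ toWord W l ] })
           (trans (length-adj c a) (sym (length-adj c′ a)))

    neighborQuery-agree : ∀ ma dst wdst (s : Config W (2 * k)) → returned s x < k →
                          neighborQuery G ma dst wdst s ≡ neighborQuery H ma dst wdst s
    neighborQuery-agree nothing  dst wdst s _ = refl
    neighborQuery-agree (just a) dst wdst s r<k
      with head (drop (returned s a) (adj G a)) | head (drop (returned s a) (adj H a))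
         | entry-agree a (returned s a) (λ { refl → r<k })
    ... | nothing | _ | refl = refl
    ... | just _  | _ | refl = refl

    execute-agree : ∀ i (s : Config W (2 * k)) → returned s x < k → execute G i s ≡ execute H i s
    execute-agree (word-op f dst a b) s _ = refl
    execute-agree (load a ptr) s _ = refl
    execute-agree (store a ptr) s _ = refl
    execute-agree (jump-if f a b l) s _ = refl
    execute-agree (weight-op f dst a b) s _ = refl
    execute-agree (load-weight a ptr) s _ = refl
    execute-agree (store-weight a ptr) s _ = refl
    execute-agree (jump-if-weight f a b l) s _ = refl
    execute-agree (degree u dst) s _ =
      cong (next G) (degreeQuery-agree (toVertex W (2 * k) (words s u)) dst s)
    execute-agree (neighbor u dst wdst) s r<k =
      cong (next G) (neighborQuery-agree (toVertex W (2 * k) (words s u)) dst wdst s r<k)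
    execute-agree (emit u w) s _ = refl
    execute-agree halt s _ = refl

    step-agree : ∀ P (s : Config W (2 * k)) → returned s x < k → step G P s ≡ step H P s
    step-agree P s r<k with head (drop (pc s) P)
    ... | nothing = refl
    ... | just i  = execute-agree i s r<k

    -- The initial memory depends on the graph only through its numbers of vertices and edges.
    initial-agree : initial {W} G ≡ initial {W} H
    initial-agree = cong
      (λ l → config 0 (((λ _ → toWord W 0) [ 1 ≔ toWord W l ]) [ 0 ≔ toWord W (2 * k) ])
                    (λ _ → fromℚ 0ℚ) (λ _ → 0) [])
      (m-network c c′)

    -- Counters never decrease, so the bound at time `t` holds at all earlier times, and each step
    -- on the way sees the same entries in both networks.
    run-agree : ∀ P t → returned (run {W} G P t) x < k → run {W} G P t ≡ run {W} H P t
    run-agree P zero    _   = initial-agree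
    run-agree P (suc t) r<k = trans (step-agree P (run G P t) r<k′) (cong (step H P) (run-agree P t r<k′))
      where
      r<k′ : returned (run {W} G P t) x < k
      r<k′ = ≤-<-trans (returned-step-≥ G P (run G P t) x) r<k

  -- Finding a vertex whose list is insufficiently explored.

  -- Candidates for the source of a cheap arc into `v`: the arc must not be a loop, must differ from
  -- the emitted `(u , v)`, and must come late in its list.
  nearExcept : Vertex → Vertex → List Vertex
  nearExcept u v = filter (λ x → ¬? (x Fin.≟ u)) (filter (λ x → ¬? (x Fin.≟ v)) (near v))

  ∈-nearExcept⁻ : ∀ {u v x} → x ∈ nearExcept u v → x ∈ near v × x ≢ u × x ≢ v
  ∈-nearExcept⁻ {v = v} x∈ =
    let x∈′ , x≢u    = ∈-filter⁻ _ {xs = filter (λ x → ¬? (x Fin.≟ v)) (near v)} x∈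
        x∈near , x≢v = ∈-filter⁻ _ {xs = near v} x∈′
    in x∈near , x≢u , x≢v

  nearExcept-unique : ∀ u v → Unique (nearExcept u v)
  nearExcept-unique u v = Unique.filter⁺ _ (Unique.filter⁺ _ (block-unique (quotient k v)))

  length-nearExcept-≥ : ∀ u v → k ≤ 2 + length (nearExcept u v)
  length-nearExcept-≥ u v = begin
    k                                                      ≡⟨ length-block (quotient k v) ⟨
    length (near v)                                        ≤⟨ length-≤-filter-≢ v near-unique ⟩
    1 + length (filter (λ x → ¬? (x Fin.≟ v)) (near v))    ≤⟨ s≤s (length-≤-filter-≢ u (Unique.filter⁺ _ near-unique)) ⟩
    2 + length (nearExcept u v)                            ∎
    where
    open ≤-Reasoning
    near-unique = block-unique (quotient k v)

  -- Pigeonhole: otherwise each of at least `k - 2` candidates has had `k` entries returned, which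
  -- takes `(k - 2) * k` steps. The term `2 * k` stands on the left to avoid truncated subtraction.
  unexplored-vertex : ∀ {W} cost P t → 2 * k + t < k * k → ∀ u v →
    ∃[ x ] x ∈ near v × x ≢ u × x ≢ v × returned (run {W} (network cost) P t) x < k
  unexplored-vertex {W} cost P t small u v
    with any? (λ x → returned (run {W} (network cost) P t) x <? k) (nearExcept u v)
  ... | yes found =
    let x , x∈ , r<k           = find found
        x∈near , x≢u , x≢v     = ∈-nearExcept⁻ x∈
    in x , x∈near , x≢u , x≢v , r<k
  ... | no none = contradiction small (≤⇒≯ (begin
    k * k                                  ≤⟨ *-monoˡ-≤ k (length-nearExcept-≥ u v) ⟩
    (2 + length (nearExcept u v)) * k      ≡⟨ *-distribʳ-+ k 2 (length (nearExcept u v)) ⟩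
    2 * k + length (nearExcept u v) * k
      ≤⟨ +-monoʳ-≤ (2 * k) (sum-map-≥ _ (All.map ≮⇒≥ (¬Any⇒All¬ (nearExcept u v) none))) ⟩
    2 * k + sum (map (returned (run (network cost) P t)) (nearExcept u v))
      ≤⟨ +-monoʳ-≤ (2 * k) (sum-returned-≤ (network cost) P t (nearExcept-unique u v)) ⟩
    2 * k + t                              ∎))
    where open ≤-Reasoning

  -- An arc of weight -1 lies in every minimum tree.

  cheapArc : Vertex → Vertex → Vertex → Vertex → ℚ
  cheapArc x v a b = if does (a Fin.≟ x) ∧ does (b Fin.≟ v) then ℚ.- 1ℚ else 0ℚ

  module _ (x v : Vertex) where

    cheapArc-≡ : cheapArc x v x v ≡ ℚ.- 1ℚ
    cheapArc-≡ rewrite dec-true (x Fin.≟ x) refl | dec-true (v Fin.≟ v) refl = refl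

    cheapArc-≢ : ∀ a b → a ≢ x ⊎ b ≢ v → 0ℚ ≡ cheapArc x v a b
    cheapArc-≢ a b a≢⊎b≢ with a Fin.≟ x | b Fin.≟ v
    ... | no  _   | _       = refl
    ... | yes _   | no _    = refl
    ... | yes a≡x | yes b≡v with a≢⊎b≢
    ...   | inj₁ a≢x = contradiction a≡x a≢x
    ...   | inj₂ b≢v = contradiction b≡v b≢v

    cheapArc-≤0 : ∀ a b → cheapArc x v a b ℚ.≤ 0ℚ
    cheapArc-≤0 a b with does (a Fin.≟ x) ∧ does (b Fin.≟ v)
    ... | true  = ℚ.nonPositive⁻¹ (ℚ.- 1ℚ)
    ... | false = ℚ.≤-refl

    private
      G = network (cheapArc x v)

      cost-of : ∀ {e} i → e ∈ edges G → seq (weight e) i ≡ cheapArc x v (source e) (target e)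
      cost-of i e∈ = cong (λ w → seq w i) (∈-edges-weight (cheapArc x v) e∈)

      star-total-≤ : v ≢ x → ∀ i → seq (total (star G x)) i ℚ.≤ ℚ.- 1ℚ
      star-total-≤ v≢x i = ℚ.≤-trans
        (seq-total-≤ i
          (All.tabulate λ {e} e∈ →
            subst (ℚ._≤ 0ℚ) (sym (cost-of i (lookup (star⊆edges G x) e∈))) (cheapArc-≤0 (source e) (target e)))
          (∈-star (cheapArc x v) x v v≢x))
        (ℚ.≤-reflexive cheapArc-≡)

      IsCheap : Edge (2 * k) → Set
      IsCheap e = source e ≡ x × target e ≡ v

      other-end : ∀ e → ¬ IsCheap e → source e ≢ x ⊎ target e ≢ v
      other-end e ¬cheap with source e Fin.≟ x
      ... | no  s≢x = inj₁ s≢x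
      ... | yes s≡x = inj₂ λ t≡v → ¬cheap (s≡x , t≡v)

      total-zero : ∀ {T} → T ⊆ edges G → ¬ Any IsCheap T → ∀ i → seq (total T) i ≡ 0ℚ
      total-zero {T} T⊆ none i = seq-total-zero T i (All.tabulate λ {e} e∈ →
        trans (cost-of i (lookup T⊆ e∈))
              (sym (cheapArc-≢ (source e) (target e) (other-end e (All.lookup (¬Any⇒All¬ T none) e∈)))))

      not-cheaper-than-star : ∀ {T} → v ≢ x → T ⊆ edges G → ¬ Any IsCheap T → ¬ (total T ≤ℝ total (star G x))
      not-cheaper-than-star {T} v≢x T⊆ none T≤star = not-≤ (T≤star ½ (ℚ.positive⁻¹ ½))
        where
        not-≤ : ¬ (∃[ N ] ∀ i → N ≤ i → seq (total T) i ℚ.≤ seq (total (star G x)) i ℚ.+ ½)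
        not-≤ (N , le) = ℚ.<-irrefl refl (ℚ.≤-<-trans 0≤ (ℚ.negative⁻¹ (ℚ.- 1ℚ ℚ.+ ½)))
          where
          0≤ : 0ℚ ℚ.≤ ℚ.- 1ℚ ℚ.+ ½
          0≤ = ℚ.≤-trans
            (subst (ℚ._≤ seq (total (star G x)) N ℚ.+ ½) (total-zero T⊆ none N) (le N ≤-refl))
            (ℚ.+-monoˡ-≤ ½ (star-total-≤ v≢x N))

    -- A tree without this arc has total 0, whereas the star at `x` has total at most -1. Membership
    -- is decidable, so refuting its absence yields the arc.
    cheapArc∈MDST : ∀ {T} → v ≢ x → IsMDST (network (cheapArc x v)) T →
                    ∃[ e ] e ∈ T × source e ≡ x × target e ≡ v
    cheapArc∈MDST {T} v≢x ((branching , _) , minimal) = find (decidable-stable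
      (any? (λ e → (source e Fin.≟ x) ×-dec (target e Fin.≟ v)) T)
      λ none → not-cheaper-than-star v≢x (IsOutBranching.subgraph branching) none
                 (minimal (star G x) (network-star-isDST (cheapArc x v) x)))

    source-of-arc-to-v : ∀ {T e} → v ≢ x → IsMDST (network (cheapArc x v)) T →
                         e ∈ T → target e ≡ v → source e ≡ x
    source-of-arc-to-v v≢x mdst@((branching , _) , _) e∈ e→v =
      let e′ , e′∈ , x→e′ , e′→v = cheapArc∈MDST v≢x mdst
      in trans (cong source (indegree≤1⇒≡ (IsOutBranching.indegree≤1 branching v) e∈ e→v e′∈ e′→v)) x→e′

  -- The adversary argument. Speed on the zero-weight network forces an early emission, and
  -- correctness on a network with a cheap arc then refutes it. The cheap arc is fixed only after
  -- that emission is known, hence the quantification over `x` and `v`.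
  not-enumerated : ∀ {W P pre del} → 2 * k + (pre + del) < k * k → {u v : Vertex} → u ≢ v →
    EnumeratesMDST W P (network λ _ _ → 0ℚ) pre del →
    ¬ (∀ x v → ∃[ pre′ ] ∃[ del′ ] EnumeratesMDST W P (network (cheapArc x v)) pre′ del′)
  not-enumerated {W} {P} {pre} {del} small u₀≢v₀ E₀ enumerates =
    let open EnumeratesMDST
        T                                = pre + del
        _ , p∈                           = 0<length⇒∈ (first E₀
          (WeaklyConnected⇒nonempty u₀≢v₀ (proj₂ (proj₁ (isMDST E₀)))))
        e₀ , _ , p≡e₀                    = emitted⇒∈tree (network λ _ _ → 0ℚ) E₀ T p∈
        u                                = source e₀
        v                                = target e₀
        x , x∈near , x≢u , x≢v , r<k     = unexplored-vertex {W} (λ _ _ → 0ℚ) P T small u v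
        _ , _ , E                        = enumerates x v
        -- By time `T` the list of `x` has not been read as far as `v`, so the same pair is emitted
        -- on the modified network.
        same-run                         = Indistinguishable.run-agree {W} (λ _ _ → 0ℚ) (cheapArc x v)
          (cheapArc-≢ x v) (near⇒∉far x∈near) P T r<k
        e , e∈ , p≡e                     = emitted⇒∈tree (network (cheapArc x v)) E T
          (subst (λ c → _ ∈ output c) same-run p∈)
        e≡e₀                             = trans (sym p≡e) p≡e₀
        e→v                              = toℕ-injective (cong proj₂ e≡e₀)
        u→e                              = toℕ-injective (cong proj₁ e≡e₀)
    -- The emitted edge enters `v`, so minimality makes its source `x`, but its source is `u`.
    in x≢u (trans (sym (source-of-arc-to-v x v (x≢v ∘ sym) (isMDST E) e∈ e→v)) u→e)

-- Choice of constants against the asymptotic bounds.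

theorem14 : ∀ (wordSize : ℕ → ℕ) → wordSize ∈Ω (λ k → ⌊log₂ k ⌋) →
    ¬ (∃[ P ] ∃[ preprocessing ] ∃[ delay ]
    (preprocessing ∈o (λ k → k)) × (delay ∈o (λ k → k)) ×
    SolvesMDSTEnumeration wordSize P preprocessing delay)
theorem14 wordSize _ (P , pre , del , pre∈o , del∈o , solves)
  -- With `M` at most `4 * k * k`, the factor 16 bounds preprocessing plus delay by `M / 8`, hence
  -- by half of `k * k`.
  with N₁ , pre≤ ← pre∈o 16 | N₂ , del≤ ← del∈o 16 =
  not-enumerated {P = P} small {zero} {suc zero} (λ ()) (solve (λ _ _ → 0ℚ)) (λ x v → _ , _ , solve (cheapArc x v))
  where
  -- The inequality `2 * k + k * k / 2 < k * k` holds once `k` exceeds 4; the rest puts `M` above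
  -- both thresholds.
  k = 5 + (N₁ + N₂)
  open CompleteDigraph k
  solve : ∀ c → EnumeratesMDST (wordSize (2 * k)) P (network c) (pre (m (network c))) (del (m (network c)))
  solve c = solves (network c) (_ , network-star-isDST c zero)
  M = m (network λ _ _ → 0ℚ)
  k≤M : k ≤ M
  k≤M = m-≥ _ zero
  T = pre M + del M
  16T≤ : 16 * T ≤ 8 * (k * k)
  16T≤ = begin
    16 * T                    ≡⟨ *-distribˡ-+ 16 (pre M) (del M) ⟩
    16 * pre M + 16 * del M   ≤⟨ +-mono-≤ (pre≤ M (≤-trans (≤-trans (m≤m+n N₁ N₂) (m≤n+m _ 5)) k≤M))
                                          (del≤ M (≤-trans (≤-trans (m≤n+m N₂ N₁) (m≤n+m _ 5)) k≤M)) ⟩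
    M + M                     ≤⟨ +-mono-≤ (m-≤ _) (m-≤ _) ⟩
    2 * k * (2 * k) + 2 * k * (2 * k) ≡⟨ expand k ⟩
    8 * (k * k)               ∎
    where
    open ≤-Reasoning
    expand : ∀ k → 2 * k * (2 * k) + 2 * k * (2 * k) ≡ 8 * (k * k)
    expand = solve-∀
  small : 2 * k + T < k * k
  small = *-cancelˡ-< 16 _ _ (begin-strict
    16 * (2 * k + T)         ≡⟨ *-distribˡ-+ 16 (2 * k) T ⟩
    16 * (2 * k) + 16 * T    ≤⟨ +-monoʳ-≤ (16 * (2 * k)) 16T≤ ⟩
    16 * (2 * k) + 8 * (k * k) ≡⟨ cong (_+ 8 * (k * k)) (regroup k) ⟩
    -- Strictness comes from `4 < k`, which unfolds to `5 ≤ k`.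
    8 * (4 * k) + 8 * (k * k)  <⟨ +-monoˡ-< (8 * (k * k)) (*-monoʳ-< 8 (*-monoˡ-< k (m≤m+n 5 (N₁ + N₂)))) ⟩
    8 * (k * k) + 8 * (k * k) ≡⟨ *-distribʳ-+ (k * k) 8 8 ⟨
    16 * (k * k)             ∎)
    where
    open ≤-Reasoning
    regroup : ∀ k → 16 * (2 * k) ≡ 8 * (4 * k)
    regroup = solve-∀
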